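{- Let $G$ be a subgroup of $\mathrm{Gl}_n(\mathbb{C})$. If $G$ is nilpotent, torsion-free, and not abelian, then $G$ contains a non-diagonalizable element.
   Context: Diagonalizable means diagonalizable over $\mathbb{C}$, i.e. conjugate in $\mathrm{Gl}_n(\mathbb{C})$ to a diagonal matrix. -}

module Defs where

open import Algebra.Bundles using (CommutativeRing; Group; Monoid)
open import Algebra.Definitions using (Commutative)
open import Algebra.Structures using (IsCommutativeRing)
import Algebra.Definitions.RawMonoid as RawMonoidDefinitions
import Algebra.Properties.Monoid as MonoidProperties
import Algebra.Properties.Ring as RingProperties
import Algebra.Properties.Semiring.Sum as SemiringSum
import Algebra.Solver.Ring.NaturalCoefficients.Default as SemiringSolver
open import Data.Fin.Base using (Fin; zero; suc)
open import Data.Nat.Base as ℕ using (ℕ; zero; suc)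
import Data.Nat.Properties as ℕ
open import Data.Product.Base using (Σ; ∃-syntax; _×_; _,_; proj₁; proj₂)
open import Data.Rational.Base as ℚ using (ℚ; 0ℚ; 1ℚ; ½; ∣_∣; 1/_)
import Data.Rational.Properties as ℚ
open import Data.Rational.Solver using (module +-*-Solver)
open import Function.Base using (_∘_; const)
open import Level using (Level; 0ℓ; _⊔_) renaming (suc to lsuc)
open import Relation.Binary.Core using (Rel)
open import Relation.Binary.Definitions using (_Respects_)
open import Relation.Binary.PropositionalEquality as ≡ using (_≡_; _≢_; cong; subst)
import Relation.Binary.Reasoning.Setoid as SetoidReasoning
open import Relation.Unary using (Pred; _∈_)

private
  variable
    c ℓ p : Level

IsCauchy : (ℕ → ℚ) → Set
IsCauchy x = ∀ ε → 0ℚ ℚ.< ε →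
  ∃[ N ] (∀ m n → N ℕ.≤ m → N ℕ.≤ n → ∣ x m ℚ.- x n ∣ ℚ.< ε)

IsNull : (ℕ → ℚ) → Set
IsNull x = ∀ ε → 0ℚ ℚ.< ε → ∃[ N ] (∀ n → N ℕ.≤ n → ∣ x n ∣ ℚ.< ε)

-- Real numbers are Cauchy sequences of rationals, identified (by _≈ᴿ_) when
-- their difference is a null sequence.
record ℝ : Set where
  constructor mkℝ
  field
    seq    : ℕ → ℚ
    cauchy : IsCauchy seq

open ℝ public

infix 4 _≈ᴿ_

_≈ᴿ_ : Rel ℝ 0ℓ
x ≈ᴿ y = IsNull (λ n → seq x n ℚ.- seq y n)

open +-*-Solver using (solve; _:=_; _:+_; _:*_; :-_; _:-_)

half+half : ∀ ε → ε ℚ.* ½ ℚ.+ ε ℚ.* ½ ≡ ε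
half+half ε = ≡.trans (≡.sym (ℚ.*-distribˡ-+ ε ½ ½)) (ℚ.*-identityʳ ε)

half>0 : ∀ ε → 0ℚ ℚ.< ε → 0ℚ ℚ.< ε ℚ.* ½
half>0 ε ε>0 = subst (ℚ._< ε ℚ.* ½) (ℚ.*-zeroˡ ½) (ℚ.*-monoˡ-<-pos ½ ε>0)

+-small : ∀ ε a b → ∣ a ∣ ℚ.< ε ℚ.* ½ → ∣ b ∣ ℚ.< ε ℚ.* ½ → ∣ a ℚ.+ b ∣ ℚ.< ε
+-small ε a b a<ε/2 b<ε/2 = subst (∣ a ℚ.+ b ∣ ℚ.<_) (half+half ε)
  (ℚ.≤-<-trans (ℚ.∣p+q∣≤∣p∣+∣q∣ a b) (ℚ.+-mono-< a<ε/2 b<ε/2))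

-- δ B ε is the tolerance ε / B.
δ : ∀ B → 0ℚ ℚ.< B → ℚ → ℚ
δ B B>0 ε = ε ℚ.* (1/ B) {{ℚ.>-nonZero B>0}}

δ>0 : ∀ B (B>0 : 0ℚ ℚ.< B) ε → 0ℚ ℚ.< ε → 0ℚ ℚ.< δ B B>0 ε
δ>0 B B>0 ε ε>0 = subst (ℚ._< ε ℚ.* B⁻¹) (ℚ.*-zeroˡ B⁻¹) (ℚ.*-monoˡ-<-pos B⁻¹ ε>0)
  where
  B⁻¹ = (1/ B) {{ℚ.>-nonZero B>0}}
  instance
    B⁻¹-pos : ℚ.Positive B⁻¹
    B⁻¹-pos = ℚ.1/pos⇒pos B {{ℚ.positive B>0}}

*-small : ∀ B (B>0 : 0ℚ ℚ.< B) ε a b → ∣ a ∣ ℚ.< B → ∣ b ∣ ℚ.< δ B B>0 ε → ∣ a ℚ.* b ∣ ℚ.< ε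
*-small B B>0 ε a b a<B b<δ = begin-strict
  ∣ a ℚ.* b ∣             ≡⟨ ℚ.∣p*q∣≡∣p∣*∣q∣ a b ⟩
  ∣ a ∣ ℚ.* ∣ b ∣         ≤⟨ ℚ.*-monoʳ-≤-nonNeg ∣ b ∣ {{ℚ.∣-∣-nonNeg b}} (ℚ.<⇒≤ a<B) ⟩
  B ℚ.* ∣ b ∣             <⟨ ℚ.*-monoʳ-<-pos B {{ℚ.positive B>0}} b<δ ⟩
  B ℚ.* (ε ℚ.* B⁻¹)       ≡⟨ solve 3 (λ B ε B⁻¹ → B :* (ε :* B⁻¹) := ε :* (B :* B⁻¹)) ≡.refl B ε B⁻¹ ⟩
  ε ℚ.* (B ℚ.* B⁻¹)       ≡⟨ cong (ε ℚ.*_) (ℚ.*-inverseʳ B {{ℚ.>-nonZero B>0}}) ⟩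
  ε ℚ.* 1ℚ                ≡⟨ ℚ.*-identityʳ ε ⟩
  ε                       ∎
  where
  open ℚ.≤-Reasoning
  B⁻¹ = (1/ B) {{ℚ.>-nonZero B>0}}

*-diff-small : ∀ B (B>0 : 0ℚ ℚ.< B) C (C>0 : 0ℚ ℚ.< C) ε x u y v →
  ∣ x ∣ ℚ.< B → ∣ v ∣ ℚ.< C →
  ∣ x ℚ.- y ∣ ℚ.< δ C C>0 (ε ℚ.* ½) → ∣ u ℚ.- v ∣ ℚ.< δ B B>0 (ε ℚ.* ½) →
  ∣ x ℚ.* u ℚ.- y ℚ.* v ∣ ℚ.< ε
*-diff-small B B>0 C C>0 ε x u y v x<B v<C x-y<δ u-v<δ =
  subst (λ q → ∣ q ∣ ℚ.< ε)
    (solve 4 (λ x u y v → x :* (u :- v) :+ v :* (x :- y) := x :* u :- y :* v) ≡.refl x u y v)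
    (+-small ε (x ℚ.* (u ℚ.- v)) (v ℚ.* (x ℚ.- y))
      (*-small B B>0 (ε ℚ.* ½) x (u ℚ.- v) x<B u-v<δ)
      (*-small C C>0 (ε ℚ.* ½) v (x ℚ.- y) v<C x-y<δ))

bounded : ∀ x → IsCauchy x → ∃[ B ] 0ℚ ℚ.< B × ∃[ N ] (∀ n → N ℕ.≤ n → ∣ x n ∣ ℚ.< B)
bounded x cau = B , B>0 , N , bound
  where
  1>0 : 0ℚ ℚ.< 1ℚ
  1>0 = ℚ.positive⁻¹ 1ℚ
  N = proj₁ (cau 1ℚ 1>0)
  B = 1ℚ ℚ.+ ∣ x N ∣
  B>0 : 0ℚ ℚ.< B
  B>0 = ℚ.+-mono-<-≤ 1>0 (ℚ.0≤∣p∣ (x N))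
  bound : ∀ n → N ℕ.≤ n → ∣ x n ∣ ℚ.< B
  bound n N≤n = subst (λ q → ∣ q ∣ ℚ.< B)
    (solve 2 (λ a b → (a :- b) :+ b := a) ≡.refl (x n) (x N))
    (ℚ.≤-<-trans (ℚ.∣p+q∣≤∣p∣+∣q∣ (x n ℚ.- x N) (x N))
      (ℚ.+-monoˡ-< ∣ x N ∣ (proj₂ (cau 1ℚ 1>0) n N N≤n ℕ.≤-refl)))

⊔-≤ˡ : ∀ M N {n} → M ℕ.⊔ N ℕ.≤ n → M ℕ.≤ n
⊔-≤ˡ M N = ℕ.≤-trans (ℕ.m≤m⊔n M N)

⊔-≤ʳ : ∀ M N {n} → M ℕ.⊔ N ℕ.≤ n → N ℕ.≤ n
⊔-≤ʳ M N = ℕ.≤-trans (ℕ.m≤n⊔m M N)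

+-cauchy : ∀ {x y} → IsCauchy x → IsCauchy y → IsCauchy (λ n → x n ℚ.+ y n)
+-cauchy {x} {y} cx cy ε ε>0
  with M , x-small ← cx (ε ℚ.* ½) (half>0 ε ε>0)
     | N , y-small ← cy (ε ℚ.* ½) (half>0 ε ε>0)
  = M ℕ.⊔ N , λ m n ≤m ≤n → subst (λ q → ∣ q ∣ ℚ.< ε)
      (solve 4 (λ a b c d → (a :- b) :+ (c :- d) := (a :+ c) :- (b :+ d)) ≡.refl
        (x m) (x n) (y m) (y n))
      (+-small ε (x m ℚ.- x n) (y m ℚ.- y n)
        (x-small m n (⊔-≤ˡ M N ≤m) (⊔-≤ˡ M N ≤n))
        (y-small m n (⊔-≤ʳ M N ≤m) (⊔-≤ʳ M N ≤n)))

-‿cauchy : ∀ {x} → IsCauchy x → IsCauchy (λ n → ℚ.- x n)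
-‿cauchy {x} cx ε ε>0 with N , small ← cx ε ε>0
  = N , λ m n ≤m ≤n → subst (ℚ._< ε)
      (≡.trans (≡.sym (ℚ.∣-p∣≡∣p∣ (x m ℚ.- x n)))
        (cong ∣_∣ (solve 2 (λ a b → :- (a :- b) := (:- a) :- (:- b)) ≡.refl (x m) (x n))))
      (small m n ≤m ≤n)

*-cauchy : ∀ {x y} → IsCauchy x → IsCauchy y → IsCauchy (λ n → x n ℚ.* y n)
*-cauchy {x} {y} cx cy ε ε>0 = N , λ m n ≤m ≤n →
  *-diff-small B B>0 C C>0 ε (x m) (y m) (x n) (y n)
    (x<B m (≤⇒K≤ ≤m)) (y<C n (≤⇒L≤ ≤n))
    (x-small m n (≤⇒M≤ ≤m) (≤⇒M≤ ≤n))
    (y-small m n (≤⇒P≤ ≤m) (≤⇒P≤ ≤n))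
  where
  open Σ (bounded x cx) renaming (proj₁ to B; proj₂ to B-bound)
  open Σ B-bound renaming (proj₁ to B>0; proj₂ to x-bound)
  open Σ x-bound renaming (proj₁ to K; proj₂ to x<B)
  open Σ (bounded y cy) renaming (proj₁ to C; proj₂ to C-bound)
  open Σ C-bound renaming (proj₁ to C>0; proj₂ to y-bound)
  open Σ y-bound renaming (proj₁ to L; proj₂ to y<C)
  open Σ (cx (δ C C>0 (ε ℚ.* ½)) (δ>0 C C>0 (ε ℚ.* ½) (half>0 ε ε>0)))
    renaming (proj₁ to M; proj₂ to x-small)
  open Σ (cy (δ B B>0 (ε ℚ.* ½)) (δ>0 B B>0 (ε ℚ.* ½) (half>0 ε ε>0)))
    renaming (proj₁ to P; proj₂ to y-small)
  N = (K ℕ.⊔ L) ℕ.⊔ (M ℕ.⊔ P)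
  ≤⇒K≤ : ∀ {n} → N ℕ.≤ n → K ℕ.≤ n
  ≤⇒K≤ = ⊔-≤ˡ K L ∘ ⊔-≤ˡ (K ℕ.⊔ L) (M ℕ.⊔ P)
  ≤⇒L≤ : ∀ {n} → N ℕ.≤ n → L ℕ.≤ n
  ≤⇒L≤ = ⊔-≤ʳ K L ∘ ⊔-≤ˡ (K ℕ.⊔ L) (M ℕ.⊔ P)
  ≤⇒M≤ : ∀ {n} → N ℕ.≤ n → M ℕ.≤ n
  ≤⇒M≤ = ⊔-≤ˡ M P ∘ ⊔-≤ʳ (K ℕ.⊔ L) (M ℕ.⊔ P)
  ≤⇒P≤ : ∀ {n} → N ℕ.≤ n → P ℕ.≤ n
  ≤⇒P≤ = ⊔-≤ʳ M P ∘ ⊔-≤ʳ (K ℕ.⊔ L) (M ℕ.⊔ P)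

const-cauchy : ∀ q → IsCauchy (const q)
const-cauchy q ε ε>0 = 0 , λ _ _ _ _ → subst (λ r → ∣ r ∣ ℚ.< ε) (≡.sym (ℚ.+-inverseʳ q)) ε>0

infixl 6 _+ᴿ_
infixl 7 _*ᴿ_
infix  8 -ᴿ_

fromℚ : ℚ → ℝ
fromℚ q = mkℝ (const q) (const-cauchy q)

_+ᴿ_ : ℝ → ℝ → ℝ
x +ᴿ y = mkℝ (λ n → seq x n ℚ.+ seq y n) (+-cauchy {seq x} {seq y} (cauchy x) (cauchy y))

_*ᴿ_ : ℝ → ℝ → ℝ
x *ᴿ y = mkℝ (λ n → seq x n ℚ.* seq y n) (*-cauchy {seq x} {seq y} (cauchy x) (cauchy y))

-ᴿ_ : ℝ → ℝ
-ᴿ x = mkℝ (λ n → ℚ.- seq x n) (-‿cauchy {seq x} (cauchy x))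

pointwise⇒≈ : ∀ x y → (∀ n → seq x n ≡ seq y n) → x ≈ᴿ y
pointwise⇒≈ x y x≡y ε ε>0 = 0 , λ n _ → subst (λ r → ∣ r ∣ ℚ.< ε)
  (≡.sym (≡.trans (cong (ℚ._- seq y n) (x≡y n)) (ℚ.+-inverseʳ (seq y n)))) ε>0

≈ᴿ-sym : ∀ {x y} → x ≈ᴿ y → y ≈ᴿ x
≈ᴿ-sym {x} {y} x≈y ε ε>0 with N , small ← x≈y ε ε>0
  = N , λ n ≤n → subst (ℚ._< ε)
      (≡.trans (≡.sym (ℚ.∣-p∣≡∣p∣ (seq x n ℚ.- seq y n)))
        (cong ∣_∣ (solve 2 (λ a b → :- (a :- b) := b :- a) ≡.refl (seq x n) (seq y n))))
      (small n ≤n)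

≈ᴿ-trans : ∀ {x y z} → x ≈ᴿ y → y ≈ᴿ z → x ≈ᴿ z
≈ᴿ-trans {x} {y} {z} x≈y y≈z ε ε>0
  with M , xy-small ← x≈y (ε ℚ.* ½) (half>0 ε ε>0)
     | N , yz-small ← y≈z (ε ℚ.* ½) (half>0 ε ε>0)
  = M ℕ.⊔ N , λ n ≤n → subst (λ q → ∣ q ∣ ℚ.< ε)
      (solve 3 (λ a b c → (a :- b) :+ (b :- c) := a :- c) ≡.refl (seq x n) (seq y n) (seq z n))
      (+-small ε (seq x n ℚ.- seq y n) (seq y n ℚ.- seq z n)
        (xy-small n (⊔-≤ˡ M N ≤n)) (yz-small n (⊔-≤ʳ M N ≤n)))

+ᴿ-cong : ∀ {x y u v} → x ≈ᴿ y → u ≈ᴿ v → x +ᴿ u ≈ᴿ y +ᴿ v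
+ᴿ-cong {x} {y} {u} {v} x≈y u≈v ε ε>0
  with M , xy-small ← x≈y (ε ℚ.* ½) (half>0 ε ε>0)
     | N , uv-small ← u≈v (ε ℚ.* ½) (half>0 ε ε>0)
  = M ℕ.⊔ N , λ n ≤n → subst (λ q → ∣ q ∣ ℚ.< ε)
      (solve 4 (λ a b c d → (a :- b) :+ (c :- d) := (a :+ c) :- (b :+ d)) ≡.refl
        (seq x n) (seq y n) (seq u n) (seq v n))
      (+-small ε (seq x n ℚ.- seq y n) (seq u n ℚ.- seq v n)
        (xy-small n (⊔-≤ˡ M N ≤n)) (uv-small n (⊔-≤ʳ M N ≤n)))

-ᴿ-cong : ∀ {x y} → x ≈ᴿ y → -ᴿ x ≈ᴿ -ᴿ y
-ᴿ-cong {x} {y} x≈y ε ε>0 with N , small ← x≈y ε ε>0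
  = N , λ n ≤n → subst (ℚ._< ε)
      (≡.trans (≡.sym (ℚ.∣-p∣≡∣p∣ (seq x n ℚ.- seq y n)))
        (cong ∣_∣ (solve 2 (λ a b → :- (a :- b) := (:- a) :- (:- b)) ≡.refl (seq x n) (seq y n))))
      (small n ≤n)

*ᴿ-cong : ∀ {x y u v} → x ≈ᴿ y → u ≈ᴿ v → x *ᴿ u ≈ᴿ y *ᴿ v
*ᴿ-cong {x} {y} {u} {v} x≈y u≈v ε ε>0 = N , λ n ≤n →
  *-diff-small B B>0 C C>0 ε (seq x n) (seq u n) (seq y n) (seq v n)
    (x<B n (⊔-≤ˡ K L (≤⇒KL≤ ≤n))) (v<C n (⊔-≤ʳ K L (≤⇒KL≤ ≤n)))
    (xy-small n (⊔-≤ˡ M P (≤⇒MP≤ ≤n))) (uv-small n (⊔-≤ʳ M P (≤⇒MP≤ ≤n)))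
  where
  open Σ (bounded (seq x) (cauchy x)) renaming (proj₁ to B; proj₂ to B-bound)
  open Σ B-bound renaming (proj₁ to B>0; proj₂ to x-bound)
  open Σ x-bound renaming (proj₁ to K; proj₂ to x<B)
  open Σ (bounded (seq v) (cauchy v)) renaming (proj₁ to C; proj₂ to C-bound)
  open Σ C-bound renaming (proj₁ to C>0; proj₂ to v-bound)
  open Σ v-bound renaming (proj₁ to L; proj₂ to v<C)
  open Σ (x≈y (δ C C>0 (ε ℚ.* ½)) (δ>0 C C>0 (ε ℚ.* ½) (half>0 ε ε>0)))
    renaming (proj₁ to M; proj₂ to xy-small)
  open Σ (u≈v (δ B B>0 (ε ℚ.* ½)) (δ>0 B B>0 (ε ℚ.* ½) (half>0 ε ε>0)))
    renaming (proj₁ to P; proj₂ to uv-small)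
  N = (K ℕ.⊔ L) ℕ.⊔ (M ℕ.⊔ P)
  ≤⇒KL≤ : ∀ {n} → N ℕ.≤ n → K ℕ.⊔ L ℕ.≤ n
  ≤⇒KL≤ = ⊔-≤ˡ (K ℕ.⊔ L) (M ℕ.⊔ P)
  ≤⇒MP≤ : ∀ {n} → N ℕ.≤ n → M ℕ.⊔ P ℕ.≤ n
  ≤⇒MP≤ = ⊔-≤ʳ (K ℕ.⊔ L) (M ℕ.⊔ P)

ℝ-isCommutativeRing : IsCommutativeRing _≈ᴿ_ _+ᴿ_ _*ᴿ_ -ᴿ_ (fromℚ 0ℚ) (fromℚ 1ℚ)
ℝ-isCommutativeRing = record
  { isRing = record
    { +-isAbelianGroup = record
      { isGroup = record
        { isMonoid = record
          { isSemigroup = record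
            { isMagma = record
              { isEquivalence = record
                { refl  = λ {x} → pointwise⇒≈ x x (λ _ → ≡.refl)
                ; sym   = λ {x} {y} → ≈ᴿ-sym {x} {y}
                ; trans = λ {x} {y} {z} → ≈ᴿ-trans {x} {y} {z}
                }
              ; ∙-cong = λ {x} {y} {u} {v} → +ᴿ-cong {x} {y} {u} {v}
              }
            ; assoc = λ x y z → pointwise⇒≈ ((x +ᴿ y) +ᴿ z) (x +ᴿ (y +ᴿ z))
                (λ n → ℚ.+-assoc (seq x n) (seq y n) (seq z n))
            }
          ; identity = (λ x → pointwise⇒≈ (0ᴿ +ᴿ x) x (λ n → ℚ.+-identityˡ (seq x n)))
                     , (λ x → pointwise⇒≈ (x +ᴿ 0ᴿ) x (λ n → ℚ.+-identityʳ (seq x n)))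
          }
        ; inverse = (λ x → pointwise⇒≈ ((-ᴿ x) +ᴿ x) 0ᴿ (λ n → ℚ.+-inverseˡ (seq x n)))
                  , (λ x → pointwise⇒≈ (x +ᴿ (-ᴿ x)) 0ᴿ (λ n → ℚ.+-inverseʳ (seq x n)))
        ; ⁻¹-cong = λ {x} {y} → -ᴿ-cong {x} {y}
        }
      ; comm = λ x y → pointwise⇒≈ (x +ᴿ y) (y +ᴿ x) (λ n → ℚ.+-comm (seq x n) (seq y n))
      }
    ; *-cong = λ {x} {y} {u} {v} → *ᴿ-cong {x} {y} {u} {v}
    ; *-assoc = λ x y z → pointwise⇒≈ ((x *ᴿ y) *ᴿ z) (x *ᴿ (y *ᴿ z))
        (λ n → ℚ.*-assoc (seq x n) (seq y n) (seq z n))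
    ; *-identity = (λ x → pointwise⇒≈ (1ᴿ *ᴿ x) x (λ n → ℚ.*-identityˡ (seq x n)))
                 , (λ x → pointwise⇒≈ (x *ᴿ 1ᴿ) x (λ n → ℚ.*-identityʳ (seq x n)))
    ; distrib = (λ x y z → pointwise⇒≈ (x *ᴿ (y +ᴿ z)) (x *ᴿ y +ᴿ x *ᴿ z)
                  (λ n → ℚ.*-distribˡ-+ (seq x n) (seq y n) (seq z n)))
              , (λ x y z → pointwise⇒≈ ((y +ᴿ z) *ᴿ x) (y *ᴿ x +ᴿ z *ᴿ x)
                  (λ n → ℚ.*-distribʳ-+ (seq x n) (seq y n) (seq z n)))
    }
  ; *-comm = λ x y → pointwise⇒≈ (x *ᴿ y) (y *ᴿ x) (λ n → ℚ.*-comm (seq x n) (seq y n))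
  }
  where
  0ᴿ = fromℚ 0ℚ
  1ᴿ = fromℚ 1ℚ

ℝ-commutativeRing : CommutativeRing 0ℓ 0ℓ
ℝ-commutativeRing = record { isCommutativeRing = ℝ-isCommutativeRing }

-- The ring R[i] with i² = -1.
module AdjoinI (R : CommutativeRing c ℓ) where
  open CommutativeRing R renaming (Carrier to A)

  infix 5 _+i_

  record Carrierᵢ : Set c where
    constructor _+i_
    field
      re im : A

  open Carrierᵢ public

  infix  4 _≈ᵢ_
  infixl 6 _+ᵢ_
  infixl 7 _*ᵢ_
  infix  8 -ᵢ_

  _≈ᵢ_ : Rel Carrierᵢ ℓ
  z ≈ᵢ w = re z ≈ re w × im z ≈ im w

  _+ᵢ_ : Carrierᵢ → Carrierᵢ → Carrierᵢ
  z +ᵢ w = (re z + re w) +i (im z + im w)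

  _*ᵢ_ : Carrierᵢ → Carrierᵢ → Carrierᵢ
  z *ᵢ w = (re z * re w - im z * im w) +i (re z * im w + im z * re w)

  -ᵢ_ : Carrierᵢ → Carrierᵢ
  -ᵢ z = (- re z) +i (- im z)

  0ᵢ 1ᵢ : Carrierᵢ
  0ᵢ = 0# +i 0#
  1ᵢ = 1# +i 0#

  open RingProperties ring using (-1*x≈-x)
  open SemiringSolver commutativeSemiring using ()
    renaming (solve to solveᴿ; _:=_ to _⊜_; _:+_ to _⊕_; _:*_ to _⊗_)

  ≈ᵢ-trans : ∀ z w v → z ≈ᵢ w → w ≈ᵢ v → z ≈ᵢ v
  ≈ᵢ-trans _ _ _ (p , q) (r , s) = trans p r , trans q s

  *ᵢ-cong : ∀ z w u v → z ≈ᵢ w → u ≈ᵢ v → z *ᵢ u ≈ᵢ w *ᵢ v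
  *ᵢ-cong _ _ _ _ (p , q) (r , s) =
      +-cong (*-cong p r) (-‿cong (*-cong q s))
    , +-cong (*-cong p s) (*-cong q r)

  *ᵢ-comm : ∀ z w → z *ᵢ w ≈ᵢ w *ᵢ z
  *ᵢ-comm (a +i b) (c +i d) =
      +-cong (*-comm a c) (-‿cong (*-comm b d))
    , trans (+-comm _ _) (+-cong (*-comm b c) (*-comm a d))

  *ᵢ-identityˡ : ∀ z → 1ᵢ *ᵢ z ≈ᵢ z
  *ᵢ-identityˡ (a +i b) =
      trans (+-cong (*-identityˡ a) (trans (-‿cong (zeroˡ b)) -0≈0)) (+-identityʳ a)
    , trans (+-cong (*-identityˡ b) (zeroˡ a)) (+-identityʳ b)
    where
    -0≈0 : - 0# ≈ 0#
    -0≈0 = trans (sym (+-identityˡ (- 0#))) (-‿inverseʳ 0#)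

  -- The semiring solver does not know negation, so -x is passed to it as k * x with k = -1.
  k = - 1#

  re-≈ : ∀ x y → x - y ≈ x + k * y
  re-≈ x y = +-congˡ (sym (-1*x≈-x y))

  *ᵢ-assoc : ∀ z w v → (z *ᵢ w) *ᵢ v ≈ᵢ z *ᵢ (w *ᵢ v)
  *ᵢ-assoc (a +i b) (c +i d) (e +i f) =
      trans (trans (re-≈ _ _) (+-congʳ (*-congʳ (re-≈ _ _)))) (trans
        (solveᴿ 7 (λ a b c d e f k →
          (a ⊗ c ⊕ k ⊗ (b ⊗ d)) ⊗ e ⊕ k ⊗ ((a ⊗ d ⊕ b ⊗ c) ⊗ f)
          ⊜ a ⊗ (c ⊗ e ⊕ k ⊗ (d ⊗ f)) ⊕ k ⊗ (b ⊗ (c ⊗ f ⊕ d ⊗ e)))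
          refl a b c d e f k)
        (sym (trans (re-≈ _ _) (+-congʳ (*-congˡ (re-≈ _ _))))))
    , trans (+-congʳ (*-congʳ (re-≈ _ _))) (trans
        (solveᴿ 7 (λ a b c d e f k →
          (a ⊗ c ⊕ k ⊗ (b ⊗ d)) ⊗ f ⊕ (a ⊗ d ⊕ b ⊗ c) ⊗ e
          ⊜ a ⊗ (c ⊗ f ⊕ d ⊗ e) ⊕ b ⊗ (c ⊗ e ⊕ k ⊗ (d ⊗ f)))
          refl a b c d e f k)
        (sym (+-congˡ (*-congˡ (re-≈ _ _)))))

  *ᵢ-distribˡ : ∀ z w v → z *ᵢ (w +ᵢ v) ≈ᵢ (z *ᵢ w) +ᵢ (z *ᵢ v)
  *ᵢ-distribˡ (a +i b) (c +i d) (e +i f) =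
      trans (re-≈ _ _) (trans
        (solveᴿ 7 (λ a b c d e f k →
          a ⊗ (c ⊕ e) ⊕ k ⊗ (b ⊗ (d ⊕ f))
          ⊜ (a ⊗ c ⊕ k ⊗ (b ⊗ d)) ⊕ (a ⊗ e ⊕ k ⊗ (b ⊗ f)))
          refl a b c d e f k)
        (sym (+-cong (re-≈ _ _) (re-≈ _ _))))
    , solveᴿ 6 (λ a b c d e f →
        a ⊗ (d ⊕ f) ⊕ b ⊗ (c ⊕ e)
        ⊜ (a ⊗ d ⊕ b ⊗ c) ⊕ (a ⊗ f ⊕ b ⊗ e)) refl a b c d e f

  *ᵢ-identityʳ : ∀ z → z *ᵢ 1ᵢ ≈ᵢ z
  *ᵢ-identityʳ z = ≈ᵢ-trans (z *ᵢ 1ᵢ) (1ᵢ *ᵢ z) z (*ᵢ-comm z 1ᵢ) (*ᵢ-identityˡ z)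

  *ᵢ-distribʳ : ∀ z w v → (w +ᵢ v) *ᵢ z ≈ᵢ (w *ᵢ z) +ᵢ (v *ᵢ z)
  *ᵢ-distribʳ z w v = ≈ᵢ-trans ((w +ᵢ v) *ᵢ z) (z *ᵢ (w +ᵢ v)) ((w *ᵢ z) +ᵢ (v *ᵢ z))
    (*ᵢ-comm (w +ᵢ v) z)
    (≈ᵢ-trans (z *ᵢ (w +ᵢ v)) ((z *ᵢ w) +ᵢ (z *ᵢ v)) ((w *ᵢ z) +ᵢ (v *ᵢ z))
      (*ᵢ-distribˡ z w v)
      ( +-cong (proj₁ (*ᵢ-comm z w)) (proj₁ (*ᵢ-comm z v))
      , +-cong (proj₂ (*ᵢ-comm z w)) (proj₂ (*ᵢ-comm z v))))

  isCommutativeRingᵢ : IsCommutativeRing _≈ᵢ_ _+ᵢ_ _*ᵢ_ -ᵢ_ 0ᵢ 1ᵢ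
  isCommutativeRingᵢ = record
    { isRing = record
      { +-isAbelianGroup = record
        { isGroup = record
          { isMonoid = record
            { isSemigroup = record
              { isMagma = record
                { isEquivalence = record
                  { refl  = refl , refl
                  ; sym   = λ (p , q) → sym p , sym q
                  ; trans = λ {z} {w} {v} → ≈ᵢ-trans z w v
                  }
                ; ∙-cong = λ (p , q) (r , s) → +-cong p r , +-cong q s
                }
              ; assoc = λ z w v → +-assoc (re z) (re w) (re v) , +-assoc (im z) (im w) (im v)
              }
            ; identity = (λ z → +-identityˡ (re z) , +-identityˡ (im z))
                       , (λ z → +-identityʳ (re z) , +-identityʳ (im z))
            }
          ; inverse = (λ z → -‿inverseˡ (re z) , -‿inverseˡ (im z))
                    , (λ z → -‿inverseʳ (re z) , -‿inverseʳ (im z))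
          ; ⁻¹-cong = λ (p , q) → -‿cong p , -‿cong q
          }
        ; comm = λ z w → +-comm (re z) (re w) , +-comm (im z) (im w)
        }
      ; *-cong = λ {z} {w} {u} {v} → *ᵢ-cong z w u v
      ; *-assoc = *ᵢ-assoc
      ; *-identity = *ᵢ-identityˡ , *ᵢ-identityʳ
      ; distrib = *ᵢ-distribˡ , *ᵢ-distribʳ
      }
    ; *-comm = *ᵢ-comm
    }

  commutativeRing : CommutativeRing c ℓ
  commutativeRing = record { isCommutativeRing = isCommutativeRingᵢ }

ℂ : CommutativeRing 0ℓ 0ℓ
ℂ = AdjoinI.commutativeRing ℝ-commutativeRing

module _ (M : Monoid c ℓ) where
  open Monoid M

  record Unit : Set (c ⊔ ℓ) where
    field
      val      : Carrier
      inv      : Carrier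
      inverseˡ : inv ∙ val ≈ ε
      inverseʳ : val ∙ inv ≈ ε

  open Unit

  units : Group (c ⊔ ℓ) ℓ
  units = record
    { Carrier = Unit
    -- The inverse is determined by the element, so it is ignored by equality.
    ; _≈_     = λ u v → val u ≈ val v
    ; _∙_     = λ u v → record
      { val      = val u ∙ val v
      ; inv      = inv v ∙ inv u
      ; inverseˡ = trans (cancelᶜ (inverseˡ u) (inv v) (val v)) (inverseˡ v)
      ; inverseʳ = trans (cancelᶜ (inverseʳ v) (val u) (inv u)) (inverseʳ u)
      }
    ; ε       = record { val = ε ; inv = ε ; inverseˡ = identityˡ ε ; inverseʳ = identityˡ ε }
    ; _⁻¹     = λ u → record
      { val = inv u ; inv = val u ; inverseˡ = inverseʳ u ; inverseʳ = inverseˡ u }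
    ; isGroup = record
      { isMonoid = record
        { isSemigroup = record
          { isMagma = record
            { isEquivalence = record { refl = refl ; sym = sym ; trans = trans }
            ; ∙-cong        = ∙-cong
            }
          ; assoc = λ u v w → assoc (val u) (val v) (val w)
          }
        ; identity = (λ u → identityˡ (val u)) , (λ u → identityʳ (val u))
        }
      ; inverse = inverseˡ , inverseʳ
      ; ⁻¹-cong = λ {u} {v} u≈v → begin
          inv u                     ≈⟨ insertʳ (inverseʳ v) (inv u) ⟩
          (inv u ∙ val v) ∙ inv v   ≈⟨ ∙-congʳ (∙-congˡ u≈v) ⟨
          (inv u ∙ val u) ∙ inv v   ≈⟨ elimˡ (inverseˡ u) (inv v) ⟩
          inv v                     ∎
      }
    }
    where
    open MonoidProperties M
    open SetoidReasoning setoid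

record Subgroup (G : Group c ℓ) p : Set (c ⊔ ℓ ⊔ lsuc p) where
  open Group G
  field
    carrier   : Pred Carrier p
    resp      : carrier Respects _≈_
    ε-closed  : ε ∈ carrier
    ∙-closed  : ∀ {x y} → x ∈ carrier → y ∈ carrier → x ∙ y ∈ carrier
    ⁻¹-closed : ∀ {x} → x ∈ carrier → x ⁻¹ ∈ carrier

  group : Group (c ⊔ p) ℓ
  group = record
    { Carrier = Σ Carrier carrier
    ; _≈_     = λ x y → proj₁ x ≈ proj₁ y
    ; _∙_     = λ x y → proj₁ x ∙ proj₁ y , ∙-closed (proj₂ x) (proj₂ y)
    ; ε       = ε , ε-closed
    ; _⁻¹     = λ x → proj₁ x ⁻¹ , ⁻¹-closed (proj₂ x)
    ; isGroup = record
      { isMonoid = record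
        { isSemigroup = record
          { isMagma = record
            { isEquivalence = record { refl = refl ; sym = sym ; trans = trans }
            ; ∙-cong        = ∙-cong
            }
          ; assoc = λ x y z → assoc (proj₁ x) (proj₁ y) (proj₁ z)
          }
        ; identity = (λ x → identityˡ (proj₁ x)) , (λ x → identityʳ (proj₁ x))
        }
      ; inverse = (λ x → inverseˡ (proj₁ x)) , (λ x → inverseʳ (proj₁ x))
      ; ⁻¹-cong = ⁻¹-cong
      }
    }

module _ (G : Group c ℓ) where
  open Group G
  -- The library's additively named n × x is here the power xⁿ.
  open RawMonoidDefinitions rawMonoid using () renaming (_×_ to _×ᴳ_)

  Abelian : Set (c ⊔ ℓ)
  Abelian = Commutative _≈_ _∙_

  TorsionFree : Set (c ⊔ ℓ)
  TorsionFree = ∀ x n .{{_ : ℕ.NonZero n}} → n ×ᴳ x ≈ ε → x ≈ ε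

  commutator : Carrier → Carrier → Carrier
  commutator x y = x ∙ y ∙ x ⁻¹ ∙ y ⁻¹

  -- The upper central series Zᵢ: the image of x is central in G/Zᵢ precisely
  -- when every commutator [x,y] lies in Zᵢ.
  data UpperCentral : ℕ → Pred Carrier (c ⊔ ℓ) where
    trivial : ∀ {x} → x ≈ ε → x ∈ UpperCentral zero
    central : ∀ {i x} → (∀ y → commutator x y ∈ UpperCentral i) → x ∈ UpperCentral (suc i)

  Nilpotent : Set (c ⊔ ℓ)
  Nilpotent = ∃[ i ] (∀ x → x ∈ UpperCentral i)

module _ (R : CommutativeRing c ℓ) where
  open CommutativeRing R
  open SemiringSum semiring

  Matrix : ℕ → Set c
  Matrix n = Fin n → Fin n → Carrier

  identityMatrix : ∀ {n} → Matrix n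
  identityMatrix zero    zero    = 1#
  identityMatrix zero    (suc j) = 0#
  identityMatrix (suc i) zero    = 0#
  identityMatrix (suc i) (suc j) = identityMatrix i j

  sum-zero : ∀ {n} (f : Fin n → Carrier) → (∀ k → f k ≈ 0#) → sum f ≈ 0#
  sum-zero {n} f f≈0 = trans (sum-cong-≋ f≈0) (sum-replicate-zero n)

  sum-identityˡ : ∀ {n} (i : Fin n) (f : Fin n → Carrier) →
    ∑[ k < n ] (identityMatrix i k * f k) ≈ f i
  sum-identityˡ zero    f = trans
    (+-cong (*-identityˡ _) (sum-zero _ (λ k → zeroˡ (f (suc k))))) (+-identityʳ _)
  sum-identityˡ (suc i) f = trans
    (+-cong (zeroˡ _) (sum-identityˡ i (f ∘ suc))) (+-identityˡ _)

  sum-identityʳ : ∀ {n} (j : Fin n) (f : Fin n → Carrier) →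
    ∑[ k < n ] (f k * identityMatrix k j) ≈ f j
  sum-identityʳ zero    f = trans
    (+-cong (*-identityʳ _) (sum-zero _ (λ k → zeroʳ (f (suc k))))) (+-identityʳ _)
  sum-identityʳ (suc j) f = trans
    (+-cong (zeroʳ _) (sum-identityʳ j (f ∘ suc))) (+-identityˡ _)

  matrixMonoid : ℕ → Monoid c ℓ
  matrixMonoid n = record
    { Carrier  = Matrix n
    ; _≈_      = λ A B → ∀ i j → A i j ≈ B i j
    ; _∙_      = λ A B i j → ∑[ k < n ] (A i k * B k j)
    ; ε        = identityMatrix
    ; isMonoid = record
      { isSemigroup = record
        { isMagma = record
          { isEquivalence = record
            { refl  = λ i j → refl
            ; sym   = λ A≈B i j → sym (A≈B i j)
            ; trans = λ A≈B B≈C i j → trans (A≈B i j) (B≈C i j)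
            }
          ; ∙-cong = λ A≈B C≈D i j → sum-cong-≋ (λ k → *-cong (A≈B i k) (C≈D k j))
          }
        ; assoc = λ A B C i j → begin
            ∑[ k < n ] (∑[ l < n ] (A i l * B l k) * C k j)
              ≈⟨ sum-cong-≋ (λ k → *-distribʳ-sum (C k j) (λ l → A i l * B l k)) ⟩
            ∑[ k < n ] ∑[ l < n ] ((A i l * B l k) * C k j)
              ≈⟨ ∑-comm (λ k l → (A i l * B l k) * C k j) ⟩
            ∑[ l < n ] ∑[ k < n ] ((A i l * B l k) * C k j)
              ≈⟨ sum-cong-≋ (λ l → sum-cong-≋ (λ k → *-assoc (A i l) (B l k) (C k j))) ⟩
            ∑[ l < n ] ∑[ k < n ] (A i l * (B l k * C k j))
              ≈⟨ sum-cong-≋ (λ l → *-distribˡ-sum (A i l) (λ k → B l k * C k j)) ⟨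
            ∑[ l < n ] (A i l * ∑[ k < n ] (B l k * C k j))
              ∎
        }
      ; identity = (λ A i j → sum-identityˡ i (λ k → A k j)) , (λ A i j → sum-identityʳ j (A i))
      }
    }
    where open SetoidReasoning setoid

  GL : ℕ → Group (c ⊔ ℓ) ℓ
  GL n = units (matrixMonoid n)

  IsDiagonal : ∀ {n} → Pred (Matrix n) ℓ
  IsDiagonal D = ∀ {i j} → i ≢ j → D i j ≈ 0#

  Diagonalizable : ∀ {n} → Pred (Group.Carrier (GL n)) (c ⊔ ℓ)
  Diagonalizable {n} g = ∃[ P ] IsDiagonal (Unit.val (P ∙ᴳ g ∙ᴳ P ⁻¹ᴳ))
    where open Group (GL n) using () renaming (_∙_ to _∙ᴳ_; _⁻¹ to _⁻¹ᴳ)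

{-# OPTIONS --safe #-}

-- Suppose every element of G is diagonalizable. If z = [x,y] is central, let μ be
-- an eigenvalue of z. On the μ-eigenspace, x yᵏ x⁻¹ = μᵏ yᵏ, so the powers yᵏ are
-- eigenvectors of conjugation by x with eigenvalues μᵏ; only finitely many of them
-- can be independent, so μ is a root of unity. Being diagonalizable, z has finite
-- order, hence is trivial by torsion-freeness. Thus Z₂ = Z₁, the upper central
-- series is stationary, and the nilpotent group G is abelian.

module Submission where

open import Defs
open import Algebra.Bundles using (CommutativeRing; Group; Monoid)
import Algebra.Definitions.RawMonoid as RawMonoidDefinitions
import Algebra.Properties.Group as GroupProperties
import Algebra.Properties.Monoid as MonoidProperties
import Algebra.Properties.Ring as RingProperties
import Algebra.Properties.Semiring.Exp as SemiringExp
import Algebra.Properties.Semiring.Sum as SemiringSum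
import Algebra.Solver.Ring.NaturalCoefficients.Default as SemiringSolver
open import Axiom.ExcludedMiddle using (ExcludedMiddle)
open import Data.Fin.Base as Fin using (Fin; zero; suc; toℕ; punchIn; combine; remQuot)
import Data.Fin.Properties as Fin
open import Data.Nat.Base as ℕ using (ℕ; zero; suc; z≤n; s≤s; NonZero)
open import Data.Nat.Divisibility as ℕ using (_∣_; divides)
import Data.Nat.Properties as ℕ
open import Data.Product.Base using (Σ; Σ-syntax; ∃-syntax; _×_; _,_; proj₁; proj₂; uncurry)
open import Data.Rational.Base as ℚ using (ℚ; 0ℚ; 1ℚ; ½)
import Data.Rational.Properties as ℚ
open import Data.Rational.Solver using (module +-*-Solver)
open import Data.Sum.Base using (_⊎_; inj₁; inj₂; [_,_]′)
open import Data.Vec.Functional using (_∷_; insertAt; removeAt)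
open import Data.Vec.Functional.Properties using (insertAt-lookup; insertAt-punchIn)
open import Function.Base using (_∘_; id; const; flip)
open import Level using (Level; 0ℓ; _⊔_; Lift; lift; lower)
open import Relation.Binary.Definitions using (Decidable)
open import Relation.Binary.PropositionalEquality as ≡ using (_≡_; cong; subst)
import Relation.Binary.Reasoning.Setoid as SetoidReasoning
open import Relation.Nullary.Decidable using (yes; no; ¬?; map′; _×-dec_; decidable-stable)
open import Relation.Nullary.Negation using (¬_; contradiction)
open import Relation.Unary using (_∈_)

private
  variable
    c ℓ s : Level

-- Domains with decidable equality.

NoZeroDivisors : CommutativeRing c ℓ → Set (c ⊔ ℓ)
NoZeroDivisors R = ∀ {x y} → x * y ≈ 0# → x ≈ 0# ⊎ y ≈ 0#
  where open CommutativeRing R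

-- Exactly the tools of fraction-free elimination: pivots are found by testing against zero, and
-- nonzero factors are cancelled instead of inverted.
record IsDiscreteDomain (R : CommutativeRing c ℓ) : Set (c ⊔ ℓ) where
  open CommutativeRing R
  field
    _≟_            : Decidable _≈_
    noZeroDivisors : NoZeroDivisors R
    1≉0            : ¬ 1# ≈ 0#

-- The product of the `k i` works. It merges the orders of the individual eigenvalues into one
-- exponent for the whole matrix.
commonMultiple : ∀ {n} (k : Fin n → ℕ) → (∀ i → NonZero (k i)) →
  ∃[ N ] NonZero N × (∀ i → k i ∣ N)
commonMultiple {zero}  k k≢0 = 1 , _ , λ ()
commonMultiple {suc n} k k≢0 with commonMultiple (k ∘ suc) (k≢0 ∘ suc)
... | N , N≢0 , k∣N = k zero ℕ.* N , ℕ.m*n≢0 (k zero) N {{k≢0 zero}} {{N≢0}} , λ where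
  zero    → ℕ.m∣m*n N
  (suc i) → ℕ.∣n⇒∣m*n (k zero) (k∣N i)

-- Linear dependence and independence over a domain.

module LinearIndependence (R : CommutativeRing c ℓ) (domain : IsDiscreteDomain R) where

  open CommutativeRing R hiding (zero)
  open IsDiscreteDomain domain
  open SetoidReasoning setoid
  open RingProperties ring using (-‿distribˡ-*; x∙y⁻¹≈ε⇒x≈y)
  open SemiringSum semiring
  open SemiringSolver commutativeSemiring using (solve; _:=_; _:+_; _:*_)

  cancelNonZero : ∀ {x y} → ¬ x ≈ 0# → x * y ≈ 0# → y ≈ 0#
  cancelNonZero x≉0 xy≈0 = [ flip contradiction x≉0 , id ]′ (noZeroDivisors xy≈0)

  +≈0⇒ʳ : ∀ {x y} → x ≈ 0# → x + y ≈ 0# → y ≈ 0#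
  +≈0⇒ʳ {x} {y} x≈0 x+y≈0 = begin
    y       ≈⟨ +-identityˡ y ⟨
    0# + y  ≈⟨ +-congʳ x≈0 ⟨
    x + y   ≈⟨ x+y≈0 ⟩
    0#      ∎

  -- Fraction-free Gaussian elimination: with a pivot u j zero ≉ 0, each other
  -- vector v is replaced by u j zero * v - v zero * u j, so no division is needed.
  dependence : ∀ N (u : Fin (suc N) → Fin N → Carrier) →
    Σ[ a ∈ (Fin (suc N) → Carrier) ] (∃[ k ] ¬ a k ≈ 0#) × (∀ p → ∑[ k < suc N ] (a k * u k p) ≈ 0#)
  dependence zero    u = const 1# , (zero , 1≉0) , λ ()
  dependence (suc N) u with Fin.any? (λ k → ¬? (u k zero ≟ 0#))
  -- Coordinate `zero` vanishes on every vector, so it is dropped. The first vector is dropped too,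
  -- with coefficient `0#`, which keeps one more vector than coordinates.
  ... | no  allZero =
    let a , (k , aₖ≉0) , rel = dependence N (λ k p → u (suc k) (suc p)) in
    0# ∷ a , (suc k , aₖ≉0) , λ
      { zero    → sum-zero R _ (λ k → trans (*-congˡ {(0# ∷ a) k} (column≈0 k)) (zeroʳ _))
      ; (suc p) → trans (+-cong (zeroˡ _) (rel p)) (+-identityˡ 0#)
      }
    where
    column≈0 : ∀ k → u k zero ≈ 0#
    column≈0 k = decidable-stable (u k zero ≟ 0#) (λ ≉0 → allZero (k , ≉0))
  ... | yes (j , pivot≉0) = a , (punchIn j k , aₖ≉0) , relation
    where
    v : Fin (suc N) → Fin (suc N) → Carrier
    v = removeAt u j
    pivot = u j zero

    reduced : Fin (suc N) → Fin (suc N) → Carrier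
    reduced k p = pivot * v k p + - v k zero * u j p

    reduced-zero : ∀ k → reduced k zero ≈ 0#
    reduced-zero k = begin
      pivot * v k zero + - v k zero * pivot     ≈⟨ +-cong (*-comm _ _) (sym (-‿distribˡ-* _ _)) ⟩
      v k zero * pivot + - (v k zero * pivot)   ≈⟨ -‿inverseʳ _ ⟩
      0#                                        ∎

    open Σ (dependence N (λ k p → reduced k (suc p))) renaming (proj₁ to b; proj₂ to b-props)
    open Σ (proj₁ b-props) renaming (proj₁ to k; proj₂ to bₖ≉0)

    reduced-rel : ∀ p → ∑[ k < suc N ] (b k * reduced k p) ≈ 0#
    reduced-rel zero    = sum-zero R _ (λ k → trans (*-congˡ {b k} (reduced-zero k)) (zeroʳ _))
    reduced-rel (suc p) = proj₂ b-props p

    -- The pivot vector collects all the multiples of `u j` that were added in forming `reduced`.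
    aⱼ : Carrier
    aⱼ = ∑[ k < suc N ] (b k * - v k zero)

    a : Fin (suc (suc N)) → Carrier
    a = insertAt (λ k → pivot * b k) j aⱼ

    a-punchIn : ∀ k → a (punchIn j k) ≈ pivot * b k
    a-punchIn k = reflexive (insertAt-punchIn (λ k → pivot * b k) j aⱼ k)

    aₖ≉0 : ¬ a (punchIn j k) ≈ 0#
    aₖ≉0 aₖ≈0 = bₖ≉0 (cancelNonZero pivot≉0 (trans (sym (a-punchIn k)) aₖ≈0))

    relation : ∀ p → ∑[ k < suc (suc N) ] (a k * u k p) ≈ 0#
    relation p = begin
      ∑[ k < suc (suc N) ] (a k * u k p)
        ≈⟨ sum-remove {i = j} (λ k → a k * u k p) ⟩
      a j * u j p + ∑[ k < suc N ] (a (punchIn j k) * v k p)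
        ≈⟨ +-cong (*-congʳ (reflexive (insertAt-lookup _ j aⱼ)))
                  (sum-cong-≋ (λ k → *-congʳ {v k p} (a-punchIn k))) ⟩
      aⱼ * u j p + ∑[ k < suc N ] (pivot * b k * v k p)
        ≈⟨ +-congʳ (*-distribʳ-sum (u j p) (λ k → b k * - v k zero)) ⟩
      ∑[ k < suc N ] (b k * - v k zero * u j p) + ∑[ k < suc N ] (pivot * b k * v k p)
        ≈⟨ ∑-distrib-+ (λ k → b k * - v k zero * u j p) (λ k → pivot * b k * v k p) ⟨
      ∑[ k < suc N ] (b k * - v k zero * u j p + pivot * b k * v k p)
        ≈⟨ sum-cong-≋ (λ k → solve 5
             (λ b n u π v → b :* n :* u :+ π :* b :* v := b :* (π :* v :+ n :* u))
             refl (b k) (- v k zero) (u j p) pivot (v k p)) ⟩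
      ∑[ k < suc N ] (b k * reduced k p)
        ≈⟨ reduced-rel p ⟩
      0# ∎

  module _ {S : Set s} where

    -- The type `S` indexes coordinates: `w s k` is coordinate `s` of the `k`-th vector. It need not
    -- be finite, so that it can later run over all eigenvectors at once.
    Relation : ∀ {m} → (S → Fin m → Carrier) → (Fin m → Carrier) → Set (ℓ ⊔ s)
    Relation {m} w a = ∀ s → ∑[ k < m ] (a k * w s k) ≈ 0#

    -- Stability of the relations under a ↦ μ a plays the role of an operator of
    -- which the w k are eigenvectors with eigenvalues μ k.
    independence : ∀ {m} (μ : Fin m → Carrier) → (∀ {i j} → i Fin.< j → ¬ μ i ≈ μ j) →
      (w : S → Fin m → Carrier) →
      (∀ a → Relation w a → Relation w (λ k → μ k * a k)) →
      ∀ a → Relation w a → ∀ s k → a k * w s k ≈ 0#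
    independence {zero}  μ distinct w stable a rel s ()
    independence {suc m} μ distinct w stable a rel s = terms≈0
      where
      -- A relation among the later vectors is a relation among all of them with first coefficient
      -- `0#`, and scaling by `μ` preserves that zero.
      stable-tail : ∀ b → Relation (λ s → w s ∘ suc) b →
        Relation (λ s → w s ∘ suc) (λ k → μ (suc k) * b k)
      stable-tail b b-rel s = +≈0⇒ʳ (trans (*-congʳ (zeroʳ _)) (zeroˡ _))
        (stable (0# ∷ b) (λ s → trans (+-cong (zeroˡ _) (b-rel s)) (+-identityˡ 0#)) s)

      -- Subtracting `μ zero` times the relation from its `μ`-scaled version kills the first
      -- coefficient. The induction hypothesis then applies to the rest, and the nonzero factors
      -- `μ (suc k) - μ zero` cancel.
      d : Fin (suc m) → Carrier
      d k = (μ k - μ zero) * a k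

      d-rel : Relation w d
      d-rel s = begin
        ∑[ k < suc m ] ((μ k - μ zero) * a k * w s k)
          ≈⟨ sum-cong-≋ (λ k → solve 4
               (λ μ n a w → (μ :+ n) :* a :* w := μ :* a :* w :+ n :* (a :* w))
               refl (μ k) (- μ zero) (a k) (w s k)) ⟩
        ∑[ k < suc m ] (μ k * a k * w s k + - μ zero * (a k * w s k))
          ≈⟨ ∑-distrib-+ (λ k → μ k * a k * w s k) (λ k → - μ zero * (a k * w s k)) ⟩
        ∑[ k < suc m ] (μ k * a k * w s k) + ∑[ k < suc m ] (- μ zero * (a k * w s k))
          ≈⟨ +-cong (stable a rel s) (sym (*-distribˡ-sum (- μ zero) (λ k → a k * w s k))) ⟩
        0# + - μ zero * ∑[ k < suc m ] (a k * w s k)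
          ≈⟨ +-identityˡ _ ⟩
        - μ zero * ∑[ k < suc m ] (a k * w s k)
          ≈⟨ *-congˡ (rel s) ⟩
        - μ zero * 0#
          ≈⟨ zeroʳ _ ⟩
        0# ∎

      d-tail : Relation (λ s → w s ∘ suc) (d ∘ suc)
      d-tail s = +≈0⇒ʳ
        (trans (*-congʳ (trans (*-congʳ (-‿inverseʳ _)) (zeroˡ _))) (zeroˡ _)) (d-rel s)

      tail≈0 : ∀ k → a (suc k) * w s (suc k) ≈ 0#
      tail≈0 k = cancelNonZero
        (λ μₖ-μ₀≈0 → distinct (s≤s z≤n) (sym (x∙y⁻¹≈ε⇒x≈y _ _ μₖ-μ₀≈0)))
        (trans (sym (*-assoc _ _ _))
          (independence (μ ∘ suc) (λ i<j → distinct (s≤s i<j)) (λ s → w s ∘ suc)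
            stable-tail (d ∘ suc) d-tail s k))

      terms≈0 : ∀ k → a k * w s k ≈ 0#
      terms≈0 zero    = trans
        (sym (trans (+-congˡ (sum-zero R _ tail≈0)) (+-identityʳ _))) (rel s)
      terms≈0 (suc k) = tail≈0 k

-- Left eigenvectors and conjugation of powers.

module LeftEigenvectors (R : CommutativeRing c ℓ) (n : ℕ) where

  open CommutativeRing R hiding (zero)
  open SemiringSum semiring
  open SemiringExp semiring using (_^_)
  open SemiringSolver commutativeSemiring using (solve; _:=_; _:*_)
  open Group (GL R n) using () renaming (Carrier to Invertible; _∙_ to _∙ᴳ_; _≈_ to _≈ᴳ_) public
  open RawMonoidDefinitions (Group.rawMonoid (GL R n)) using () renaming (_×_ to _×ᴳ_) public
  open Unit
  module M = Monoid (matrixMonoid R n)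
  open M using (_∙_) renaming (_≈_ to _≈ᴹ_)
  open MonoidProperties (matrixMonoid R n) using (insertʳ)

  infixr 7 _·_
  _·_ : Carrier → Matrix R n → Matrix R n
  (a · A) i j = a * A i j

  ·-∙ : ∀ a A B → (a · A) ∙ B ≈ᴹ a · (A ∙ B)
  ·-∙ a A B i j = trans
    (sum-cong-≋ (λ k → *-assoc a (A i k) (B k j)))
    (sym (*-distribˡ-sum a (λ k → A i k * B k j)))

  ·-cong : ∀ a {A B} → A ≈ᴹ B → a · A ≈ᴹ a · B
  ·-cong a A≈B i j = *-congˡ (A≈B i j)

  ·-· : ∀ a b A → a · b · A ≈ᴹ (a * b) · A
  ·-· a b A i j = sym (*-assoc a b (A i j))

  IsZero : Matrix R n → Set ℓ
  IsZero A = ∀ i j → A i j ≈ 0#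

  isZero-∙ : ∀ {A} B → IsZero A → IsZero (A ∙ B)
  isZero-∙ B A≈0 i j = sum-zero R _ (λ k → trans (*-congʳ (A≈0 i k)) (zeroˡ (B k j)))

  isZero-cancel : ∀ {A} (X : Invertible) → IsZero (A ∙ val X) → IsZero A
  isZero-cancel {A} X AX≈0 i j =
    trans (insertʳ (inverseʳ X) A i j) (isZero-∙ (inv X) AX≈0 i j)

  combination-∙ʳ : ∀ {m} (a : Fin m → Carrier) (B : Fin m → Matrix R n) C →
    (∀ i j → ∑[ k < m ] (a k * B k i j) ≈ 0#) →
    ∀ i j → ∑[ k < m ] (a k * (B k ∙ C) i j) ≈ 0#
  combination-∙ʳ {m} a B C rel i j = begin
    ∑[ k < m ] (a k * ∑[ l < n ] (B k i l * C l j))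
      ≈⟨ sum-cong-≋ (λ k → *-distribˡ-sum (a k) (λ l → B k i l * C l j)) ⟩
    ∑[ k < m ] ∑[ l < n ] (a k * (B k i l * C l j))
      ≈⟨ ∑-comm (λ k l → a k * (B k i l * C l j)) ⟩
    ∑[ l < n ] ∑[ k < m ] (a k * (B k i l * C l j))
      ≈⟨ sum-cong-≋ (λ l → sum-cong-≋ (λ k → *-assoc (a k) (B k i l) (C l j))) ⟨
    ∑[ l < n ] ∑[ k < m ] (a k * B k i l * C l j)
      ≈⟨ sum-cong-≋ (λ l → *-distribʳ-sum (C l j) (λ k → a k * B k i l)) ⟨
    ∑[ l < n ] (∑[ k < m ] (a k * B k i l) * C l j)
      ≈⟨ sum-zero R _ (λ l → trans (*-congʳ (rel i l)) (zeroˡ (C l j))) ⟩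
    0# ∎
    where open SetoidReasoning setoid

  combination-∙ˡ : ∀ {m} (a : Fin m → Carrier) (B : Fin m → Matrix R n) C →
    (∀ i j → ∑[ k < m ] (a k * B k i j) ≈ 0#) →
    ∀ i j → ∑[ k < m ] (a k * (C ∙ B k) i j) ≈ 0#
  combination-∙ˡ {m} a B C rel i j = begin
    ∑[ k < m ] (a k * ∑[ l < n ] (C i l * B k l j))
      ≈⟨ sum-cong-≋ (λ k → *-distribˡ-sum (a k) (λ l → C i l * B k l j)) ⟩
    ∑[ k < m ] ∑[ l < n ] (a k * (C i l * B k l j))
      ≈⟨ ∑-comm (λ k l → a k * (C i l * B k l j)) ⟩
    ∑[ l < n ] ∑[ k < m ] (a k * (C i l * B k l j))
      ≈⟨ sum-cong-≋ (λ l → sum-cong-≋ (λ k →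
           solve 3 (λ a c b → a :* (c :* b) := c :* (a :* b)) refl (a k) (C i l) (B k l j))) ⟩
    ∑[ l < n ] ∑[ k < m ] (C i l * (a k * B k l j))
      ≈⟨ sum-cong-≋ (λ l → *-distribˡ-sum (C i l) (λ k → a k * B k l j)) ⟨
    ∑[ l < n ] (C i l * ∑[ k < m ] (a k * B k l j))
      ≈⟨ sum-zero R _ (λ l → trans (*-congˡ (rel l j)) (zeroʳ (C i l))) ⟩
    0# ∎
    where open SetoidReasoning setoid

  open SetoidReasoning M.setoid

  -- Each row of `A` lies in the left `μ`-eigenspace of `z`. Bundling rows into a square matrix
  -- makes the monoid laws of matrix multiplication available.
  LeftEigen : Matrix R n → Carrier → Matrix R n → Set ℓ
  LeftEigen z μ A = A ∙ z ≈ᴹ μ · A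

  -- A matrix commuting with `z` preserves the eigenspaces of `z`.
  leftEigen-∙ : ∀ {z x μ A} → z ∙ x ≈ᴹ x ∙ z → LeftEigen z μ A → LeftEigen z μ (A ∙ x)
  leftEigen-∙ {z} {x} {μ} {A} zx≈xz eigen = begin
    (A ∙ x) ∙ z    ≈⟨ M.assoc A x z ⟩
    A ∙ (x ∙ z)    ≈⟨ M.∙-congˡ {A} zx≈xz ⟨
    A ∙ (z ∙ x)    ≈⟨ M.assoc A z x ⟨
    (A ∙ z) ∙ x    ≈⟨ M.∙-congʳ {x} eigen ⟩
    (μ · A) ∙ x    ≈⟨ ·-∙ μ A x ⟩
    μ · (A ∙ x)    ∎

  leftEigen-power : ∀ {μ A} (z : Invertible) → LeftEigen (val z) μ A →
    ∀ k → LeftEigen (val (k ×ᴳ z)) (μ ^ k) A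
  leftEigen-power {μ} {A} z eigen zero = begin
    A ∙ M.ε   ≈⟨ M.identityʳ A ⟩
    A         ≈⟨ (λ i j → *-identityˡ (A i j)) ⟨
    1# · A    ∎
  leftEigen-power {μ} {A} z eigen (suc k) = begin
    A ∙ (val z ∙ zᵏ)     ≈⟨ M.assoc A (val z) zᵏ ⟨
    (A ∙ val z) ∙ zᵏ     ≈⟨ M.∙-congʳ {zᵏ} eigen ⟩
    (μ · A) ∙ zᵏ         ≈⟨ ·-∙ μ A zᵏ ⟩
    μ · (A ∙ zᵏ)         ≈⟨ ·-cong μ (leftEigen-power z eigen k) ⟩
    μ · μ ^ k · A        ≈⟨ ·-· μ (μ ^ k) A ⟩
    (μ * μ ^ k) · A      ∎
    where zᵏ = val (k ×ᴳ z)

  module _ (x y z : Invertible) (xy≈zyx : x ∙ᴳ y ≈ᴳ z ∙ᴳ (y ∙ᴳ x)) (zy≈yz : z ∙ᴳ y ≈ᴳ y ∙ᴳ z) where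

    private
      X = val x
      Y = val y
      Z = val z

      _**_ : Invertible → ℕ → Matrix R n
      w ** k = val (k ×ᴳ w)

    -- Moving `X` past one factor `Y` produces a `Z`, which acts on `A` as the scalar `μ`. The
    -- induction continues with `A ∙ Y`, still an eigenmatrix because `z` commutes with `y`.
    leftEigen-twist : ∀ {μ} k A → LeftEigen Z μ A →
      A ∙ (X ∙ y ** k) ≈ᴹ μ ^ k · (A ∙ (y ** k ∙ X))
    leftEigen-twist {μ} zero A eigen = begin
      A ∙ (X ∙ M.ε)           ≈⟨ M.∙-congˡ {A} (M.identityʳ X) ⟩
      A ∙ X                   ≈⟨ M.∙-congˡ {A} (M.identityˡ X) ⟨
      A ∙ (M.ε ∙ X)           ≈⟨ (λ i j → *-identityˡ _) ⟨
      1# · (A ∙ (M.ε ∙ X))    ∎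
    leftEigen-twist {μ} (suc k) A eigen = begin
      A ∙ (X ∙ (Y ∙ Yᵏ))             ≈⟨ M.∙-congˡ {A} (M.assoc X Y Yᵏ) ⟨
      A ∙ ((X ∙ Y) ∙ Yᵏ)             ≈⟨ M.∙-congˡ {A} (M.∙-congʳ {Yᵏ} xy≈zyx) ⟩
      A ∙ ((Z ∙ (Y ∙ X)) ∙ Yᵏ)       ≈⟨ M.∙-congˡ {A} (M.assoc Z (Y ∙ X) Yᵏ) ⟩
      A ∙ (Z ∙ ((Y ∙ X) ∙ Yᵏ))       ≈⟨ M.assoc A Z ((Y ∙ X) ∙ Yᵏ) ⟨
      (A ∙ Z) ∙ ((Y ∙ X) ∙ Yᵏ)       ≈⟨ M.∙-congʳ {(Y ∙ X) ∙ Yᵏ} eigen ⟩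
      (μ · A) ∙ ((Y ∙ X) ∙ Yᵏ)       ≈⟨ ·-∙ μ A ((Y ∙ X) ∙ Yᵏ) ⟩
      μ · (A ∙ ((Y ∙ X) ∙ Yᵏ))       ≈⟨ ·-cong μ (M.∙-congˡ {A} (M.assoc Y X Yᵏ)) ⟩
      μ · (A ∙ (Y ∙ (X ∙ Yᵏ)))       ≈⟨ ·-cong μ (M.assoc A Y (X ∙ Yᵏ)) ⟨
      μ · ((A ∙ Y) ∙ (X ∙ Yᵏ))
        ≈⟨ ·-cong μ (leftEigen-twist k (A ∙ Y) (leftEigen-∙ {Z} {Y} zy≈yz eigen)) ⟩
      μ · μ ^ k · ((A ∙ Y) ∙ (Yᵏ ∙ X))   ≈⟨ ·-· μ (μ ^ k) _ ⟩
      (μ * μ ^ k) · ((A ∙ Y) ∙ (Yᵏ ∙ X)) ≈⟨ ·-cong _ (M.assoc A Y (Yᵏ ∙ X)) ⟩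
      (μ * μ ^ k) · (A ∙ (Y ∙ (Yᵏ ∙ X))) ≈⟨ ·-cong _ (M.∙-congˡ {A} (M.assoc Y Yᵏ X)) ⟨
      (μ * μ ^ k) · (A ∙ ((Y ∙ Yᵏ) ∙ X)) ∎
      where Yᵏ = y ** k

    -- On the `μ`-eigenspace, conjugation by `x` multiplies the `k`-th power of `y` by `μ ^ k`. The
    -- right side is bracketed so that a relation known for the eigenmatrix `A ∙ X` can be used in
    -- it.
    leftEigen-conjugate : ∀ {μ} k A → LeftEigen Z μ A →
      μ ^ k · (A ∙ y ** k) ≈ᴹ ((A ∙ X) ∙ y ** k) ∙ inv x
    leftEigen-conjugate {μ} k A eigen = begin
      μ ^ k · (A ∙ Yᵏ)                      ≈⟨ insertʳ (inverseʳ x) (μ ^ k · (A ∙ Yᵏ)) ⟩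
      ((μ ^ k · (A ∙ Yᵏ)) ∙ X) ∙ inv x      ≈⟨ M.∙-congʳ {inv x} (·-∙ (μ ^ k) (A ∙ Yᵏ) X) ⟩
      (μ ^ k · ((A ∙ Yᵏ) ∙ X)) ∙ inv x      ≈⟨ M.∙-congʳ {inv x} (·-cong (μ ^ k) (M.assoc A Yᵏ X)) ⟩
      (μ ^ k · (A ∙ (Yᵏ ∙ X))) ∙ inv x      ≈⟨ M.∙-congʳ {inv x} (leftEigen-twist k A eigen) ⟨
      (A ∙ (X ∙ Yᵏ)) ∙ inv x                ≈⟨ M.∙-congʳ {inv x} (M.assoc A X Yᵏ) ⟨
      ((A ∙ X) ∙ Yᵏ) ∙ inv x                ∎
      where Yᵏ = y ** k

-- Roots of unity and finite order.

module FiniteOrder (R : CommutativeRing c ℓ) (domain : IsDiscreteDomain R) (n : ℕ) where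

  open CommutativeRing R hiding (zero)
  open IsDiscreteDomain domain
  open LinearIndependence R domain
  open LeftEigenvectors R n
  open RingProperties ring using (x[y-z]≈xy-xz; x≈y⇒x∙y⁻¹≈ε; x∙y⁻¹≈ε⇒x≈y)
  open SemiringSum semiring
  open SemiringExp semiring using (_^_; ^-homo-*; ^-assocʳ; ^-congˡ)
  open Unit
  open M using (_∙_) renaming (_≈_ to _≈ᴹ_)

  1^ : ∀ k → 1# ^ k ≈ 1#
  1^ zero    = refl
  1^ (suc k) = trans (*-identityˡ _) (1^ k)

  ^-∣ : ∀ {a k N} → k ∣ N → a ^ k ≈ 1# → a ^ N ≈ 1#
  ^-∣ {a} {k} {N} (divides q N≡qk) aᵏ≈1 = begin
    a ^ N           ≡⟨ ≡.cong (a ^_) (≡.trans N≡qk (ℕ.*-comm q k)) ⟩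
    a ^ (k ℕ.* q)   ≈⟨ ^-assocʳ a k q ⟨
    (a ^ k) ^ q     ≈⟨ ^-congˡ q aᵏ≈1 ⟩
    1# ^ q          ≈⟨ 1^ q ⟩
    1#              ∎
    where open SetoidReasoning setoid

  identity-diagonal : ∀ {m} (i : Fin m) → identityMatrix R i i ≈ 1#
  identity-diagonal zero    = refl
  identity-diagonal (suc i) = identity-diagonal i

  diagonal-row : ∀ {m} (D : Matrix R m) → IsDiagonal R D → ∀ i (f : Fin m → Carrier) →
    ∑[ k < m ] (D i k * f k) ≈ D i i * f i
  diagonal-row {suc m} D diagonal i f = begin
    ∑[ k < suc m ] (D i k * f k)
      ≈⟨ sum-remove {i = i} (λ k → D i k * f k) ⟩
    D i i * f i + ∑[ k < m ] (D i (punchIn i k) * f (punchIn i k))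
      ≈⟨ +-congˡ (sum-zero R _ (λ k →
           trans (*-congʳ (diagonal (Fin.punchInᵢ≢i i k ∘ ≡.sym))) (zeroˡ (f (punchIn i k))))) ⟩
    D i i * f i + 0#
      ≈⟨ +-identityʳ _ ⟩
    D i i * f i ∎
    where open SetoidReasoning setoid

  module _ (x y z : Invertible) (xy≈zyx : x ∙ᴳ y ≈ᴳ z ∙ᴳ (y ∙ᴳ x))
           (zx≈xz : z ∙ᴳ x ≈ᴳ x ∙ᴳ z) (zy≈yz : z ∙ᴳ y ≈ᴳ y ∙ᴳ z) where

    module _ {μ : Carrier} where

      Eigenvectors : Set (c ⊔ ℓ)
      Eigenvectors = Σ (Matrix R n) (LeftEigen (val z) μ)

      -- The powers of `y` as operators on the `μ`-eigenspace only: their coordinates are the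
      -- entries of `A ∙ yᵏ` for every eigenmatrix `A`.
      entries : ∀ {m} → Eigenvectors × Fin n × Fin n → Fin m → Carrier
      entries ((A , _) , i , j) k = (A ∙ val (toℕ k ×ᴳ y)) i j

      -- Since `x` commutes with `z`, the relation also holds at the eigenmatrix `A ∙ val x`.
      -- Multiplying that instance on the right by `inv x` inserts the factors `μ ^ toℕ k`.
      entries-stable : ∀ {m} (a : Fin m → Carrier) → Relation entries a →
        Relation entries (λ k → μ ^ toℕ k * a k)
      entries-stable {m} a rel ((A , eigen) , i , j) = begin
        ∑[ k < m ] (μ ^ toℕ k * a k * (A ∙ val (toℕ k ×ᴳ y)) i j)
          ≈⟨ sum-cong-≋ (λ k → trans (*-congʳ (*-comm _ (a k))) (*-assoc (a k) _ _)) ⟩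
        ∑[ k < m ] (a k * (μ ^ toℕ k * (A ∙ val (toℕ k ×ᴳ y)) i j))
          ≈⟨ sum-cong-≋ (λ k → *-congˡ {a k}
               (leftEigen-conjugate x y z xy≈zyx zy≈yz (toℕ k) A eigen i j)) ⟩
        ∑[ k < m ] (a k * (((A ∙ val x) ∙ val (toℕ k ×ᴳ y)) ∙ inv x) i j)
          ≈⟨ combination-∙ʳ a (λ k → (A ∙ val x) ∙ val (toℕ k ×ᴳ y)) (inv x)
               (λ i j → rel ((A ∙ val x , leftEigen-∙ {val z} {val x} zx≈xz eigen) , i , j)) i j ⟩
        0# ∎
        where open SetoidReasoning setoid

      -- There are n² + 1 powers of `y`, and `remQuot` flattens each to n² coordinates. A relation
      -- between them persists after multiplication on the left by any `A`.
      powers-dependent : Σ[ a ∈ (Fin (suc (n ℕ.* n)) → Carrier) ]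
        (∃[ k ] ¬ a k ≈ 0#) × Relation entries a
      powers-dependent
        with a , aₖ≉0 , rel ← dependence (n ℕ.* n)
               (λ k p → uncurry (val (toℕ k ×ᴳ y)) (remQuot n p))
        = a , aₖ≉0 , λ ((A , _) , i , j) →
            combination-∙ˡ a (λ k → val (toℕ k ×ᴳ y)) A
              (λ i j → ≡.subst
                (λ (p , q) → ∑[ k < suc (n ℕ.* n) ] (a k * val (toℕ k ×ᴳ y) p q) ≈ 0#)
                (Fin.remQuot-combine i j) (rel (combine i j)))
              i j

      module _ {A : Matrix R n} (eigen : LeftEigen (val z) μ A) (A≉0 : ¬ IsZero A) where

        -- The invertible matrix `k ×ᴳ z` acts on `A` as `μ ^ k`, so it cannot send the nonzero `A`
        -- to zero.
        eigenvalue-power≉0 : ∀ k → ¬ μ ^ k ≈ 0#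
        eigenvalue-power≉0 k μᵏ≈0 = A≉0 (isZero-cancel {A} (k ×ᴳ z)
          (λ i j → trans (leftEigen-power z eigen k i j) (trans (*-congʳ μᵏ≈0) (zeroˡ _))))

        -- On the μ-eigenvectors of z, conjugation by x multiplies yᵏ by μᵏ, so distinct
        -- powers of μ would make n² + 1 powers of y linearly independent.
        eigenvalue-rootOfUnity : ∃[ k ] NonZero k × μ ^ k ≈ 1#
        eigenvalue-rootOfUnity
          with Fin.any? {n = suc (n ℕ.* n)} (λ i → Fin.any? {n = suc (n ℕ.* n)}
                 (λ j → (i Fin.<? j) ×-dec ((μ ^ toℕ i) ≟ (μ ^ toℕ j))))
        -- A repetition gives μⁱ (1 - μʲ⁻ⁱ) = 0, and μⁱ is nonzero.
        ... | yes (i , j , i<j , μⁱ≈μʲ) =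
          k , ℕ.>-nonZero (ℕ.m<n⇒0<n∸m i<j) ,
          sym (x∙y⁻¹≈ε⇒x≈y _ _ (cancelNonZero (eigenvalue-power≉0 (toℕ i)) (begin
            μ ^ toℕ i * (1# - μ ^ k)                ≈⟨ x[y-z]≈xy-xz _ _ _ ⟩
            μ ^ toℕ i * 1# - μ ^ toℕ i * μ ^ k      ≈⟨ x≈y⇒x∙y⁻¹≈ε (begin
              μ ^ toℕ i * 1#          ≈⟨ *-identityʳ _ ⟩
              μ ^ toℕ i               ≈⟨ μⁱ≈μʲ ⟩
              μ ^ toℕ j               ≡⟨ ≡.cong (μ ^_) (ℕ.m+[n∸m]≡n (ℕ.<⇒≤ i<j)) ⟨
              μ ^ (toℕ i ℕ.+ k)       ≈⟨ ^-homo-* μ (toℕ i) k ⟩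
              μ ^ toℕ i * μ ^ k       ∎) ⟩
            0#                                      ∎)))
          where
          open SetoidReasoning setoid
          k = toℕ j ℕ.∸ toℕ i
        -- Independence makes every term of the relation vanish. At an index with nonzero
        -- coefficient this gives `A ∙ yᵏ` = 0, hence `A` = 0 because `y` is invertible.
        ... | no  distinct
          with a , (k , aₖ≉0) , rel ← powers-dependent
          = contradiction
              (isZero-cancel {A} (toℕ k ×ᴳ y) (λ i j → cancelNonZero aₖ≉0
                (independence (λ k → μ ^ toℕ k)
                  (λ i<j μⁱ≈μʲ → distinct (_ , _ , i<j , μⁱ≈μʲ))
                  entries entries-stable a rel ((A , eigen) , i , j) k)))
              A≉0

    -- From P z = D P, row `i` of `P` is a left eigenvector with eigenvalue `D i i`, a root of
    -- unity. For a common multiple `N` of the exponents, P zᴺ = P, and `P` cancels.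
    diagonalizable⇒finiteOrder : Diagonalizable R z →
      ∃[ N ] NonZero N × N ×ᴳ z ≈ᴳ Group.ε (GL R n)
    diagonalizable⇒finiteOrder (P , diagonal) =
      N , N≢0 , ∙-cancelˡ P (N ×ᴳ z) ε (λ i j → begin
          (val P ∙ val (N ×ᴳ z)) i j  ≈⟨ leftEigen-power z (eigen i) N i j ⟩
          D i i ^ N * val P i j       ≈⟨ *-congʳ (^-∣ (k∣N i) (proj₂ (proj₂ (root i)))) ⟩
          1# * val P i j              ≈⟨ *-identityˡ _ ⟩
          val P i j                   ≈⟨ M.identityʳ (val P) i j ⟨
          (val P ∙ M.ε) i j           ∎)
      where
      open SetoidReasoning setoid
      open Group (GL R n) using (ε)
      open GroupProperties (GL R n) using (∙-cancelˡ)
      open MonoidProperties (matrixMonoid R n) using (insertʳ; cancelʳ)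

      D : Matrix R n
      D = (val P ∙ val z) ∙ inv P

      -- All rows of this matrix are the i-th row of P, a left eigenvector of z.
      row : Fin n → Matrix R n
      row i _ = val P i

      eigen : ∀ i → LeftEigen (val z) (D i i) (row i)
      eigen i _ j = begin
        (val P ∙ val z) i j     ≈⟨ cancelʳ (inverseˡ P) (val P ∙ val z) i j ⟨
        (D ∙ val P) i j         ≈⟨ diagonal-row D diagonal i (λ k → val P k j) ⟩
        D i i * val P i j       ∎

      -- Row `i` of `P` times `inv P` has entry `1#` in column `i`.
      row≉0 : ∀ i → ¬ IsZero (row i)
      row≉0 i row≈0 = 1≉0 (begin
        1#                     ≈⟨ identity-diagonal i ⟨
        identityMatrix R i i   ≈⟨ inverseʳ P i i ⟨
        (row i ∙ inv P) i i    ≈⟨ isZero-∙ (inv P) row≈0 i i ⟩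
        0#                     ∎)

      root : ∀ i → ∃[ k ] NonZero k × D i i ^ k ≈ 1#
      root i = eigenvalue-rootOfUnity (eigen i) (row≉0 i)

      open Σ (commonMultiple (λ i → proj₁ (root i)) (λ i → proj₁ (proj₂ (root i))))
        renaming (proj₁ to N; proj₂ to N-props)
      open Σ N-props renaming (proj₁ to N≢0; proj₂ to k∣N)

-- Zero divisors after adjoining a square root of -1.

module _ (R : CommutativeRing c ℓ) where

  open CommutativeRing R hiding (zero)
  open AdjoinI R
  open SetoidReasoning setoid
  open RingProperties ring using (x∙y⁻¹≈ε⇒x≈y)
  open SemiringSolver commutativeSemiring using (solve; _:=_; _:+_; _:*_)

  -- Multiplying z w = 0 by the conjugate of w shows that both components of z are annihilated by
  -- the norm c² + d² of w. Either both components vanish, or the norm does, and then w = 0 by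
  -- anisotropy.
  adjoinI-noZeroDivisors : NoZeroDivisors R →
    (∀ {x y} → x * x + y * y ≈ 0# → x ≈ 0# × y ≈ 0#) → NoZeroDivisors commutativeRing
  adjoinI-noZeroDivisors noZeroDivisors anisotropic {a +i b} {c +i d} (re≈0 , im≈0) =
    bothZero⊎normZero (noZeroDivisors a*norm≈0) (noZeroDivisors b*norm≈0)
    where
    ac≈bd : a * c ≈ b * d
    ac≈bd = x∙y⁻¹≈ε⇒x≈y _ _ re≈0

    a*norm≈0 : a * (c * c + d * d) ≈ 0#
    a*norm≈0 = begin
      a * (c * c + d * d)
        ≈⟨ solve 3 (λ a c d → a :* (c :* c :+ d :* d) := a :* c :* c :+ a :* d :* d) refl a c d ⟩
      a * c * c + a * d * d    ≈⟨ +-congʳ (*-congʳ ac≈bd) ⟩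
      b * d * c + a * d * d
        ≈⟨ solve 4 (λ a b c d → b :* d :* c :+ a :* d :* d := (a :* d :+ b :* c) :* d) refl a b c d ⟩
      (a * d + b * c) * d      ≈⟨ *-congʳ im≈0 ⟩
      0# * d                   ≈⟨ zeroˡ d ⟩
      0#                       ∎

    b*norm≈0 : b * (c * c + d * d) ≈ 0#
    b*norm≈0 = begin
      b * (c * c + d * d)
        ≈⟨ solve 3 (λ b c d → b :* (c :* c :+ d :* d) := b :* c :* c :+ b :* d :* d) refl b c d ⟩
      b * c * c + b * d * d    ≈⟨ +-congˡ (*-congʳ ac≈bd) ⟨
      b * c * c + a * c * d
        ≈⟨ solve 4 (λ a b c d → b :* c :* c :+ a :* c :* d := (a :* d :+ b :* c) :* c) refl a b c d ⟩
      (a * d + b * c) * c      ≈⟨ *-congʳ im≈0 ⟩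
      0# * c                   ≈⟨ zeroˡ c ⟩
      0#                       ∎

    bothZero⊎normZero : a ≈ 0# ⊎ c * c + d * d ≈ 0# → b ≈ 0# ⊎ c * c + d * d ≈ 0# →
      (a +i b) ≈ᵢ 0ᵢ ⊎ (c +i d) ≈ᵢ 0ᵢ
    bothZero⊎normZero (inj₁ a≈0)    (inj₁ b≈0)    = inj₁ (a≈0 , b≈0)
    bothZero⊎normZero (inj₂ norm≈0) _             = inj₂ (anisotropic norm≈0)
    bothZero⊎normZero _             (inj₂ norm≈0) = inj₂ (anisotropic norm≈0)

-- Null sequences and sequences bounded away from zero.

open +-*-Solver using (solve; _:=_; _:+_; _:*_; :-_; _:-_)

null-dominated : ∀ {x y} → (∀ n → ℚ.∣ x n ∣ ℚ.≤ ℚ.∣ y n ∣) → IsNull y → IsNull x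
null-dominated x≤y null ε ε>0 with N , small ← null ε ε>0
  = N , λ n N≤n → ℚ.≤-<-trans (x≤y n) (small n N≤n)

ApartFromZero : (ℕ → ℚ) → Set
ApartFromZero x = ∃[ δ ] 0ℚ ℚ.< δ × ∃[ N ] (∀ n → N ℕ.≤ n → δ ℚ.≤ ℚ.∣ x n ∣)

-- Choose `N` beyond which terms differ by less than ε/4. A single term there of size at least ε
-- would keep all terms from `N` on at size at least ε/2, so a sequence that is not apart from zero
-- is null.
null⊎apart : ExcludedMiddle 0ℓ → ∀ {x} → IsCauchy x → IsNull x ⊎ ApartFromZero x
null⊎apart em {x} cau with em {ApartFromZero x}
... | yes apart = inj₂ apart
... | no ¬apart = inj₁ null
  where
  null : IsNull x
  null ε ε>0 with cau (ε ℚ.* ½ ℚ.* ½) (half>0 (ε ℚ.* ½) (half>0 ε ε>0))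
  ... | N , close = N , λ n N≤n → ℚ.≰⇒> (λ ε≤∣xₙ∣ → ¬apart
          (ε ℚ.* ½ , half>0 ε ε>0 , N , λ m N≤m → ℚ.≮⇒≥ (λ ∣xₘ∣<ε/2 →
            ℚ.<-irrefl ≡.refl (ℚ.<-≤-trans (subst (λ q → ℚ.∣ q ∣ ℚ.< ε) (cancel (x n) (x m))
              (+-small ε (x n ℚ.- x m) (x m)
                (ℚ.<-≤-trans (close n m N≤n N≤m) (half≤ (half>0 ε ε>0))) ∣xₘ∣<ε/2))
              ε≤∣xₙ∣))))
    where
    cancel : ∀ p q → p ℚ.- q ℚ.+ q ≡ p
    cancel = solve 2 (λ p q → p :- q :+ q := p) ≡.refl

    half≤ : ∀ {p} → 0ℚ ℚ.< p → p ℚ.* ½ ℚ.≤ p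
    half≤ {p} p>0 = subst (p ℚ.* ½ ℚ.≤_) (half+half p)
      (subst (ℚ._≤ p ℚ.* ½ ℚ.+ p ℚ.* ½) (ℚ.+-identityʳ (p ℚ.* ½))
        (ℚ.+-monoʳ-≤ (p ℚ.* ½) (ℚ.<⇒≤ (half>0 p p>0))))

null-cancel-apart : ∀ {x y} → ApartFromZero x → IsNull (λ n → x n ℚ.* y n) → IsNull y
null-cancel-apart {x} {y} (δ , δ>0 , N , δ≤x) null ε ε>0
  with M , small ← null (δ ℚ.* ε)
         (subst (ℚ._< δ ℚ.* ε) (ℚ.*-zeroʳ δ) (ℚ.*-monoʳ-<-pos δ {{ℚ.positive δ>0}} ε>0))
  = N ℕ.⊔ M , λ n ≤n → ℚ.*-cancelˡ-<-nonNeg δ {{ℚ.nonNegative (ℚ.<⇒≤ δ>0)}} (begin-strict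
      δ ℚ.* ℚ.∣ y n ∣
        ≤⟨ ℚ.*-monoʳ-≤-nonNeg ℚ.∣ y n ∣ {{ℚ.∣-∣-nonNeg (y n)}} (δ≤x n (⊔-≤ˡ N M ≤n)) ⟩
      ℚ.∣ x n ∣ ℚ.* ℚ.∣ y n ∣    ≡⟨ ℚ.∣p*q∣≡∣p∣*∣q∣ (x n) (y n) ⟨
      ℚ.∣ x n ℚ.* y n ∣          <⟨ small n (⊔-≤ʳ N M ≤n) ⟩
      δ ℚ.* ε                    ∎)
  where open ℚ.≤-Reasoning

square-nonNeg : ∀ p → 0ℚ ℚ.≤ p ℚ.* p
square-nonNeg p = subst (0ℚ ℚ.≤_) (∣p∣*∣p∣≡p*p (ℚ.∣p∣≡p∨∣p∣≡-p p))
  (subst (0ℚ ℚ.≤_) (ℚ.∣p*q∣≡∣p∣*∣q∣ p p) (ℚ.0≤∣p∣ (p ℚ.* p)))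
  where
  ∣p∣*∣p∣≡p*p : ℚ.∣ p ∣ ≡ p ⊎ ℚ.∣ p ∣ ≡ ℚ.- p → ℚ.∣ p ∣ ℚ.* ℚ.∣ p ∣ ≡ p ℚ.* p
  ∣p∣*∣p∣≡p*p (inj₁ ∣p∣≡p)  = ≡.cong₂ ℚ._*_ ∣p∣≡p ∣p∣≡p
  ∣p∣*∣p∣≡p*p (inj₂ ∣p∣≡-p) = ≡.trans (≡.cong₂ ℚ._*_ ∣p∣≡-p ∣p∣≡-p)
    (solve 1 (λ p → (:- p) :* (:- p) := p :* p) ≡.refl p)

∣p²∣≤∣p²+q²∣ : ∀ p q → ℚ.∣ p ℚ.* p ∣ ℚ.≤ ℚ.∣ p ℚ.* p ℚ.+ q ℚ.* q ∣
∣p²∣≤∣p²+q²∣ p q = begin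
  ℚ.∣ p ℚ.* p ∣                ≡⟨ ℚ.0≤p⇒∣p∣≡p (square-nonNeg p) ⟩
  p ℚ.* p                      ≡⟨ ℚ.+-identityʳ (p ℚ.* p) ⟨
  p ℚ.* p ℚ.+ 0ℚ               ≤⟨ ℚ.+-monoʳ-≤ (p ℚ.* p) (square-nonNeg q) ⟩
  p ℚ.* p ℚ.+ q ℚ.* q          ≡⟨ ℚ.0≤p⇒∣p∣≡p (ℚ.+-mono-≤ (square-nonNeg p) (square-nonNeg q)) ⟨
  ℚ.∣ p ℚ.* p ℚ.+ q ℚ.* q ∣    ∎
  where open ℚ.≤-Reasoning

≈0⇒null : ∀ {x} → x ≈ᴿ fromℚ 0ℚ → IsNull (seq x)
≈0⇒null {x} = null-dominated (λ n → ℚ.≤-reflexive (cong ℚ.∣_∣ (≡.sym (ℚ.+-identityʳ (seq x n)))))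

null⇒≈0 : ∀ {x} → IsNull (seq x) → x ≈ᴿ fromℚ 0ℚ
null⇒≈0 {x} = null-dominated (λ n → ℚ.≤-reflexive (cong ℚ.∣_∣ (ℚ.+-identityʳ (seq x n))))

-- The complex numbers as a domain with decidable equality.

module Complex (em : ExcludedMiddle 0ℓ) where

  ℝ-noZeroDivisors : NoZeroDivisors ℝ-commutativeRing
  ℝ-noZeroDivisors {x} {y} xy≈0 with null⊎apart em (cauchy x)
  ... | inj₁ null  = inj₁ (null⇒≈0 {x} null)
  ... | inj₂ apart = inj₂ (null⇒≈0 {y} (null-cancel-apart apart (≈0⇒null {x *ᴿ y} xy≈0)))

  -- Termwise x² is at most x² + y², so x² is null, and a real number with square zero is zero.
  ℝ-summand≈0 : ∀ {x y} → x *ᴿ x +ᴿ y *ᴿ y ≈ᴿ fromℚ 0ℚ → x ≈ᴿ fromℚ 0ℚ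
  ℝ-summand≈0 {x} {y} sum≈0 = [ id , id ]′ (ℝ-noZeroDivisors {x} {x} (null⇒≈0 {x *ᴿ x}
    (null-dominated (λ n → ∣p²∣≤∣p²+q²∣ (seq x n) (seq y n)) (≈0⇒null {x *ᴿ x +ᴿ y *ᴿ y} sum≈0))))

  ℂ-noZeroDivisors : NoZeroDivisors ℂ
  ℂ-noZeroDivisors {z} {w} = adjoinI-noZeroDivisors ℝ-commutativeRing
    (λ {x} {y} → ℝ-noZeroDivisors {x} {y})
    (λ {x} {y} sum≈0 → ℝ-summand≈0 {x} {y} sum≈0 ,
      ℝ-summand≈0 {y} {x} (≈ᴿ-trans {y *ᴿ y +ᴿ x *ᴿ x} {x *ᴿ x +ᴿ y *ᴿ y} {fromℚ 0ℚ}
        (CommutativeRing.+-comm ℝ-commutativeRing (y *ᴿ y) (x *ᴿ x)) sum≈0))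
    {z} {w}

  ℂ-1≉0 : ¬ CommutativeRing._≈_ ℂ (CommutativeRing.1# ℂ) (CommutativeRing.0# ℂ)
  ℂ-1≉0 (re≈0 , _) with N , small ← re≈0 1ℚ (ℚ.positive⁻¹ 1ℚ)
    -- With tolerance `1ℚ`, the constant difference 1 - 0 would have to satisfy 1 < 1.
    = ℚ.<-irrefl ≡.refl (small N ℕ.≤-refl)

  ℂ-isDiscreteDomain : IsDiscreteDomain ℂ
  ℂ-isDiscreteDomain = record
    { _≟_            = λ _ _ → em
    ; noZeroDivisors = λ {z} {w} → ℂ-noZeroDivisors {z} {w}
    ; 1≉0            = ℂ-1≉0
    }

-- Equality in `ℂ` and diagonalizability live at level `0ℓ`, whereas the subgroup predicate may live
-- at any level `p`.
lower-em : ∀ {p} → ExcludedMiddle p → ExcludedMiddle 0ℓ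
lower-em {p} em {P} = map′ lower lift (em {Lift p P})

-- Commutators and the upper central series.

module _ (G : Group c ℓ) where
  open Group G
  open GroupProperties G using (x∙y⁻¹≈ε⇒x≈y; x≈y⇒x∙y⁻¹≈ε; ⁻¹-anti-homo-∙; ε⁻¹≈ε)
  open SetoidReasoning setoid

  commutator≈ε⇒comm : ∀ {x y} → commutator G x y ≈ ε → x ∙ y ≈ y ∙ x
  commutator≈ε⇒comm {x} {y} [x,y]≈ε = x∙y⁻¹≈ε⇒x≈y (x ∙ y) (y ∙ x) (begin
    x ∙ y ∙ (y ∙ x) ⁻¹       ≈⟨ ∙-congˡ (⁻¹-anti-homo-∙ y x) ⟩
    x ∙ y ∙ (x ⁻¹ ∙ y ⁻¹)    ≈⟨ assoc (x ∙ y) (x ⁻¹) (y ⁻¹) ⟨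
    commutator G x y         ≈⟨ [x,y]≈ε ⟩
    ε                        ∎)

  commutator-∙ : ∀ x y → x ∙ y ≈ commutator G x y ∙ (y ∙ x)
  commutator-∙ x y = begin
    x ∙ y                                   ≈⟨ cancelʳ (inverseˡ x) (x ∙ y) ⟨
    x ∙ y ∙ x ⁻¹ ∙ x                        ≈⟨ cancelᶜ (inverseˡ y) (x ∙ y ∙ x ⁻¹) x ⟨
    x ∙ y ∙ x ⁻¹ ∙ y ⁻¹ ∙ (y ∙ x)           ∎
    where open MonoidProperties monoid using (cancelʳ; cancelᶜ)

  commutator-ε : ∀ {x} y → x ≈ ε → commutator G x y ≈ ε
  commutator-ε {x} y x≈ε = x≈y⇒x∙y⁻¹≈ε (begin
    x ∙ y ∙ x ⁻¹    ≈⟨ ∙-cong (∙-congʳ x≈ε) (trans (⁻¹-cong x≈ε) ε⁻¹≈ε) ⟩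
    ε ∙ y ∙ ε       ≈⟨ identityʳ (ε ∙ y) ⟩
    ε ∙ y           ≈⟨ identityˡ y ⟩
    y               ∎)

  -- The hypothesis says that a commutator commuting with both of its arguments is trivial. If `x`
  -- lies in the (i+1)-st term, each commutator of `x` lies in the i-th and is central by induction,
  -- hence trivial, so `x` is central.
  nilpotent⇒abelian :
    (∀ x y z → x ∙ y ≈ z ∙ (y ∙ x) → z ∙ x ≈ x ∙ z → z ∙ y ≈ y ∙ z → z ≈ ε) →
    Nilpotent G → Abelian G
  nilpotent⇒abelian commutingCommutator≈ε (i , upperCentral) x y =
    commutator≈ε⇒comm (upperCentral⇒central (upperCentral x) y)
    where
    upperCentral⇒central : ∀ {i x} → UpperCentral G i x → ∀ y → commutator G x y ≈ ε
    upperCentral⇒central (trivial x≈ε)           y = commutator-ε y x≈ε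
    upperCentral⇒central {x = x} (central [x,-]) y =
      commutingCommutator≈ε x y (commutator G x y) (commutator-∙ x y)
        (commutator≈ε⇒comm (upperCentral⇒central ([x,-] y) x))
        (commutator≈ε⇒comm (upperCentral⇒central ([x,-] y) y))

-- Groups consisting of diagonalizable matrices.

diagonalizable⇒abelian : ∀ {p} (R : CommutativeRing c ℓ) → IsDiscreteDomain R →
  ∀ n (G : Subgroup (GL R n) p) →
  Nilpotent (Subgroup.group G) → TorsionFree (Subgroup.group G) →
  (∀ {g} → g ∈ Subgroup.carrier G → Diagonalizable R g) → Abelian (Subgroup.group G)
diagonalizable⇒abelian R domain n G nilpotent torsionFree diagonalizable =
  nilpotent⇒abelian H commutingCommutator≈ε nilpotent
  where
  H = Subgroup.group G
  open Group H
  open LeftEigenvectors R n using (_∙ᴳ_; _≈ᴳ_; _×ᴳ_)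
  open FiniteOrder R domain n
  open RawMonoidDefinitions rawMonoid using () renaming (_×_ to _×ᴴ_)

  ×-proj₁ : ∀ N g → proj₁ (N ×ᴴ g) ≡ N ×ᴳ proj₁ g
  ×-proj₁ zero    g = ≡.refl
  ×-proj₁ (suc N) g = cong (proj₁ g ∙ᴳ_) (×-proj₁ N g)

  commutingCommutator≈ε : ∀ x y z →
    x ∙ y ≈ z ∙ (y ∙ x) → z ∙ x ≈ x ∙ z → z ∙ y ≈ y ∙ z → z ≈ ε
  commutingCommutator≈ε (x , _) (y , _) (z , z∈G) xy≈zyx zx≈xz zy≈yz =
    let N , N≢0 , zᴺ≈ε =
          diagonalizable⇒finiteOrder x y z xy≈zyx zx≈xz zy≈yz (diagonalizable z∈G)
    in torsionFree (z , z∈G) N {{N≢0}}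
         (subst (_≈ᴳ Group.ε (GL R n)) (≡.sym (×-proj₁ N (z , z∈G))) zᴺ≈ε)

lemma3p4 : ∀ {p} → ExcludedMiddle p →
    ∀ (n : ℕ) (G : Subgroup (GL ℂ n) p) →
    Nilpotent (Subgroup.group G) →
    TorsionFree (Subgroup.group G) →
    ¬ Abelian (Subgroup.group G) →
    ∃[ g ] g ∈ Subgroup.carrier G × ¬ Diagonalizable ℂ g
lemma3p4 em n G nilpotent torsionFree ¬abelian = decidable-stable em
  -- `allDiagonalizable` refutes the existence of a non-diagonalizable element; a second
  -- double-negation elimination, at level `0ℓ`, turns it into diagonalizability of each element.
  (λ allDiagonalizable → ¬abelian
    (diagonalizable⇒abelian ℂ (Complex.ℂ-isDiscreteDomain em₀) n G nilpotent torsionFree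
      (λ {g} g∈G → decidable-stable em₀ (λ ¬diag → allDiagonalizable (g , g∈G , ¬diag)))))
  where
  em₀ : ExcludedMiddle 0ℓ
  em₀ = lower-em em
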